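{- There exist two cospectral trees with twelve vertices, each having characteristic polynomial $x^{12}-11x^{10}+42x^8-66x^6+39x^4-6x^2$, such that one of them is even and the other is odd.
   Context: The characteristic polynomial of a tree is the characteristic polynomial of its adjacency matrix. Two non-isomorphic trees with the same characteristic polynomial are called cospectral. Parity: a pr-tree (plane rooted tree) is a finite tree embedded in the plane with a chosen root vertex and a marked edge at the root; equivalently, a rooted tree in which the children of every vertex are linearly ordered from left to right. The bracket code of a pr-tree whose root has pr-subtrees $T_1,\dots,T_s$ (left to right) is recursively $(\,c(T_1)\cdots c(T_s)\,)$, where $c(T_i)$ is the code of $T_i$, and the one-vertex tree has code $()$. An inversion in a bracket code is a pair consisting of a closing bracket and an opening bracket, not necessarily adjacent, such that the closing bracket occurs before the opening bracket. A pr-tree is even if the number of inversions in its bracket code is even, and odd otherwise. For a tree with an even number of vertices this parity does not depend on the choice of root vertex, marked edge and plane embedding, so one speaks of even and odd trees. -}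

module Defs where

open import Data.Bool.Base using (if_then_else_)
open import Data.Fin.Base using (Fin; zero; suc; toℕ; punchIn)
open import Data.Fin.Properties using (_≟_)
open import Data.Integer.Base as ℤ using (ℤ; +_; 0ℤ; 1ℤ)
open import Data.List.Base using (List; []; _∷_; _++_; [_]; length; lookup; map; replicate)
open import Data.List.Relation.Unary.Linked using (Linked)
open import Data.List.Relation.Unary.Unique.Propositional using (Unique)
open import Data.Nat.Base using (ℕ; zero; suc; _+_; _≤_; parity)
open import Data.Parity.Base using (Parity)
open import Data.Product.Base using (Σ; _×_; ∃-syntax)
open import Data.Sum.Base using (_⊎_)
open import Data.Vec.Functional using (Vector; foldr)
open import Function.Bundles using (_↔_; _⇔_; Inverse)
open import Level using (0ℓ)
open import Relation.Binary.Core using (Rel)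
open import Relation.Binary.Construct.Closure.ReflexiveTransitive using (Star)
open import Relation.Binary.Definitions using (Decidable; Symmetric)
open import Relation.Binary.PropositionalEquality.Core using (_≡_)
open import Relation.Nullary.Decidable.Core using (does)
open import Relation.Nullary.Negation.Core using (¬_)

record Graph (n : ℕ) : Set₁ where
  field
    Adj        : Rel (Fin n) 0ℓ
    adj?       : Decidable Adj
    adj-sym    : Symmetric Adj
    adj-irrefl : ∀ {v} → ¬ Adj v v

open Graph public

AdjIso : {A B : Set} → Rel A 0ℓ → Rel B 0ℓ → Set
AdjIso {A} {B} _∼₁_ _∼₂_ =
  Σ (A ↔ B) λ f → ∀ x y → (x ∼₁ y) ⇔ (Inverse.to f x ∼₂ Inverse.to f y)

_≅_ : ∀ {n} → Graph n → Graph n → Set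
G ≅ H = AdjIso (Adj G) (Adj H)

Connected : ∀ {n} → Graph n → Set
Connected G = ∀ u v → Star (Adj G) u v

-- v ∷ vs lists the vertices of a cycle in cyclic order, each exactly once.
IsCycle : ∀ {n} → Graph n → Fin n → List (Fin n) → Set
IsCycle G v vs =
  3 ≤ length (v ∷ vs) × Unique (v ∷ vs) × Linked (Adj G) (v ∷ vs ++ [ v ])

Acyclic : ∀ {n} → Graph n → Set
Acyclic G = ∀ v vs → ¬ IsCycle G v vs

-- The empty graph is vacuously connected but is not a tree, hence 1 ≤ n.
IsTree : ∀ {n} → Graph n → Set
IsTree {n} G = 1 ≤ n × Connected G × Acyclic G

-- Polynomials over ℤ: a₀ ∷ a₁ ∷ … ∷ [] stands for a₀ + a₁ x + …, and trailing
-- zeros are allowed, so polynomials are compared by _≈_ rather than by _≡_.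

Poly : Set
Poly = List ℤ

coeff : Poly → ℕ → ℤ
coeff []      k       = 0ℤ
coeff (a ∷ p) zero    = a
coeff (a ∷ p) (suc k) = coeff p k

infix 4 _≈_
_≈_ : Poly → Poly → Set
p ≈ q = ∀ k → coeff p k ≡ coeff q k

infixl 6 _⊕_ _⊖_
infixl 7 _⊗_
infix  8 _X^_

_⊕_ : Poly → Poly → Poly
[]      ⊕ q       = q
(a ∷ p) ⊕ []      = a ∷ p
(a ∷ p) ⊕ (b ∷ q) = (a ℤ.+ b) ∷ (p ⊕ q)

neg : Poly → Poly
neg = map (λ a → ℤ.- a)

_⊖_ : Poly → Poly → Poly
p ⊖ q = p ⊕ neg q

_⊗_ : Poly → Poly → Poly
[]      ⊗ q = []
(a ∷ p) ⊗ q = map (a ℤ.*_) q ⊕ (0ℤ ∷ p ⊗ q)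

_X^_ : ℤ → ℕ → Poly
a X^ k = replicate k 0ℤ ++ [ a ]

-- The constant polynomial a; the zero constant is kept in its trimmed form.
const : ℤ → Poly
const (+ 0) = []
const a     = [ a ]

Matrix : Set → ℕ → Set
Matrix A n = Fin n → Fin n → A

sum : ∀ {n} → Vector Poly n → Poly
sum = foldr _⊕_ []

signed : ℕ → Poly → Poly
signed zero    p = p
signed (suc k) p = neg (signed k p)

-- Laplace expansion along the first row.
det : ∀ {n} → Matrix Poly n → Poly
det {zero}  M = [ 1ℤ ]
det {suc n} M = sum λ j →
  signed (toℕ j) (M zero j ⊗ det (λ i k → M (suc i) (punchIn j k)))

-- det (x I − A)
charPoly : ∀ {n} → Matrix ℤ n → Poly
charPoly A = det λ i j →
  (if does (i ≟ j) then 1ℤ X^ 1 else []) ⊖ const (A i j)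

adjacencyMatrix : ∀ {n} → Graph n → Matrix ℤ n
adjacencyMatrix G i j = if does (adj? G i j) then 1ℤ else 0ℤ

graphCharPoly : ∀ {n} → Graph n → Poly
graphCharPoly G = charPoly (adjacencyMatrix G)

Cospectral : ∀ {n} → Graph n → Graph n → Set
Cospectral G H = ¬ (G ≅ H) × graphCharPoly G ≈ graphCharPoly H

-- node ts: the pr-subtrees at the root are ts, listed from left to right.
data PRTree : Set where
  node : List PRTree → PRTree

data Bracket : Set where
  opening closing : Bracket

mutual
  code : PRTree → List Bracket
  code (node ts) = opening ∷ codes ts ++ [ closing ]

  codes : List PRTree → List Bracket
  codes []       = []
  codes (t ∷ ts) = code t ++ codes ts

openings : List Bracket → ℕ
openings []            = 0
openings (opening ∷ w) = suc (openings w)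
openings (closing ∷ w) = openings w

-- Each closing bracket is inverted with every opening bracket to its right.
inversions : List Bracket → ℕ
inversions []            = 0
inversions (opening ∷ w) = inversions w
inversions (closing ∷ w) = openings w + inversions w

prParity : PRTree → Parity
prParity t = parity (inversions (code t))

-- The underlying (unordered, unrooted) tree of a plane rooted tree; a vertex
-- is given by the path leading to it from the root.

data Vertex : PRTree → Set where
  root  : ∀ {t} → Vertex t
  below : ∀ {ts} (i : Fin (length ts)) → Vertex (lookup ts i) → Vertex (node ts)

data ChildOf : ∀ {t} → Vertex t → Vertex t → Set where
  root  : ∀ {ts} (i : Fin (length ts)) → ChildOf {node ts} (below i root) root
  below : ∀ {ts} (i : Fin (length ts)) {u v : Vertex (lookup ts i)} →
          ChildOf u v → ChildOf {node ts} (below i u) (below i v)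

PRAdj : (t : PRTree) → Rel (Vertex t) 0ℓ
PRAdj t u v = ChildOf u v ⊎ ChildOf v u

_IsPRTreeOf_ : ∀ {n} → PRTree → Graph n → Set
t IsPRTreeOf G = AdjIso (PRAdj t) (Adj G)

-- The parity of a tree is that of any pr-tree obtained from it by choosing a
-- root, a marked edge and a plane embedding. It is p when such a pr-tree exists
-- and all of them, whatever the choices, have parity p.
HasParity : ∀ {n} → Graph n → Parity → Set
HasParity G p =
  (∃[ t ] t IsPRTreeOf G) × (∀ t → t IsPRTreeOf G → prParity t ≡ p)

EvenTree OddTree : ∀ {n} → Graph n → Set
EvenTree G = HasParity G Parity.0ℙ
OddTree  G = HasParity G Parity.1ℙ

{-# OPTIONS --safe #-}

-- A closing bracket precedes an opening one exactly when the two vertices are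
-- incomparable, so the inversions of a pr-tree t on n vertices number
-- n(n-1)/2 minus the sum of the depths. Modulo 2 that sum is the size of one
-- class of the 2-colouring of the tree, and for even n both classes have sizes
-- of the same parity; hence the parity of t depends only on the underlying
-- graph. The witnesses have colour classes (6, 6) and (7, 5), so they differ in
-- parity, which also shows that they are not isomorphic; their characteristic
-- polynomials are computed.

module Submission where

open import Defs
open import Data.Empty using (⊥)
open import Data.Fin.Base using (Fin; zero; suc)
import Data.Fin.Properties as Fin
open import Data.Integer.Base using (+_)
open import Data.List.Base using (List; []; _∷_; _++_; [_]; length; lookup; map)
open import Data.List.Membership.Propositional using (_∈_)
open import Data.List.Membership.Propositional.Properties using (∈-map⁺; ∈-map⁻; ∈-++⁺ˡ; ∈-++⁺ʳ; ∈-lookup)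
open import Data.List.Membership.Propositional.Properties.WithK using (unique⇒irrelevant; unique∧set⇒bag)
open import Data.List.Properties using (length-++; length-map; map-++; map-∘; map-cong)
open import Data.List.Relation.Binary.BagAndSetEquality using (∼bag⇒↭)
open import Data.List.Relation.Binary.Permutation.Propositional using (_↭_)
open import Data.List.Relation.Binary.Permutation.Propositional.Properties using (↭-length) renaming (map⁺ to ↭-map⁺)
open import Data.List.Relation.Unary.All as All using (All; []; _∷_)
open import Data.List.Relation.Unary.AllPairs using ([]; _∷_)
open import Data.List.Relation.Unary.Any using (here; there; index)
open import Data.List.Relation.Unary.Any.Properties using (lookup-index)
open import Data.List.Relation.Unary.Linked using (Linked; _∷_)
open import Data.List.Relation.Unary.Unique.Propositional using (Unique)
import Data.List.Relation.Unary.Unique.Propositional.Properties as Unique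
open import Data.Nat.Base using (ℕ; zero; suc; _+_; _*_; _<_; parity; z≤n; s≤s)
open import Data.Nat.ListAction using () renaming (sum to sumℕ)
open import Data.Nat.ListAction.Properties using (sum-++; sum-↭)
open import Data.Nat.Properties using (+-comm; +-identityʳ; *-identityʳ; n<1+n; <-trans; <-irrefl)
open import Data.Nat.Tactic.RingSolver using (solve-∀)
open import Data.Parity.Base as ℙ using (Parity; 0ℙ; 1ℙ; _⁻¹)
import Data.Parity.Properties as ℙ
open import Data.Product.Base using (_×_; _,_; ∃-syntax; proj₁; proj₂)
open import Data.Sum.Base using (_⊎_; inj₁; inj₂; swap)
open import Function.Base using (_∘_; id)
open import Function.Bundles using (_↔_; Inverse; Equivalence; mk⇔; mk↔ₛ′)
open import Function.Construct.Composition using (_↔-∘_; _⇔-∘_)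
open import Function.Construct.Symmetry using (↔-sym)
open import Level using (0ℓ)
open import Relation.Binary.Construct.Closure.ReflexiveTransitive as Star using (Star; ε; _◅_; _◅◅_)
open import Relation.Binary.Core using (Rel)
open import Relation.Binary.Definitions using (Decidable)
open import Relation.Binary.PropositionalEquality
  using (_≡_; _≢_; refl; sym; trans; cong; cong₂; subst; subst₂; module ≡-Reasoning)
open import Relation.Nullary using (Dec; yes; no; ¬_; contradiction)
open import Relation.Nullary.Decidable using (map′; _⊎-dec_)

private variable
  t u : PRTree
  ts  : List PRTree

-- Vertices of a plane rooted tree

-- Vertices of the forest left when the root of `node ts` is removed. `Vertex` recurses only into a
-- subtree; this type also allows recursion along the list of subtrees.
ForestVertex : List PRTree → Set
ForestVertex ts = ∃[ i ] Vertex (lookup ts i)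

shift : ∀ t ts → ForestVertex ts → ForestVertex (t ∷ ts)
shift t ts (i , v) = suc i , v

graft : ∀ ts → ForestVertex ts → Vertex (node ts)
graft ts (i , v) = below i v

mutual
  vertices : ∀ t → List (Vertex t)
  vertices (node ts) = root ∷ map (graft ts) (forestVertices ts)

  forestVertices : ∀ ts → List (ForestVertex ts)
  forestVertices []       = []
  forestVertices (t ∷ ts) = map (zero ,_) (vertices t) ++ map (shift t ts) (forestVertices ts)

size : PRTree → ℕ
size t = length (vertices t)

∈-forestVertices : ∀ ts i {v : Vertex (lookup ts i)} →
                   v ∈ vertices (lookup ts i) → (i , v) ∈ forestVertices ts
∈-forestVertices (t ∷ ts) zero    v∈ = ∈-++⁺ˡ (∈-map⁺ (zero ,_) v∈)
∈-forestVertices (t ∷ ts) (suc i) v∈ =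
  ∈-++⁺ʳ (map (zero ,_) (vertices t)) (∈-map⁺ (shift t ts) (∈-forestVertices ts i v∈))

∈-vertices : (v : Vertex t) → v ∈ vertices t
∈-vertices {node ts} root        = here refl
∈-vertices {node ts} (below i v) = there (∈-map⁺ (graft ts) (∈-forestVertices ts i (∈-vertices v)))

mutual
  vertices-unique : ∀ t → Unique (vertices t)
  vertices-unique (node ts) =
    All.tabulate root≢graft ∷ Unique.map⁺ (λ { refl → refl }) (forestVertices-unique ts)
    where
    root≢graft : ∀ {v} → v ∈ map (graft ts) (forestVertices ts) → root ≢ v
    root≢graft v∈ refl with ∈-map⁻ (graft ts) v∈
    ... | _ , _ , ()

  forestVertices-unique : ∀ ts → Unique (forestVertices ts)
  forestVertices-unique []       = []
  forestVertices-unique (t ∷ ts) = Unique.++⁺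
    (Unique.map⁺ (λ { refl → refl }) (vertices-unique t))
    (Unique.map⁺ (λ { refl → refl }) (forestVertices-unique ts))
    disjoint
    where
    disjoint : ∀ {v} →
      ¬ (v ∈ map (zero ,_) (vertices t) × v ∈ map (shift t ts) (forestVertices ts))
    disjoint (v∈₁ , v∈₂) with ∈-map⁻ (zero ,_) v∈₁ | ∈-map⁻ (shift t ts) v∈₂
    ... | _ , _ , refl | _ , _ , ()

index-∈-lookup : ∀ {A : Set} (xs : List A) i → index (∈-lookup {xs = xs} i) ≡ i
index-∈-lookup (x ∷ xs) zero    = refl
index-∈-lookup (x ∷ xs) (suc i) = cong suc (index-∈-lookup xs i)

enumeration : ∀ t → Vertex t ↔ Fin (size t)
enumeration t = mk↔ₛ′ (index ∘ ∈-vertices) (lookup (vertices t))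
  -- In a duplicate-free list an element has only one membership proof, so the one from `∈-vertices`
  -- is the one given by position `i`.
  (λ i → trans (cong index (unique⇒irrelevant (vertices-unique t) _ (∈-lookup i)))
               (index-∈-lookup (vertices t) i))
  (λ v → sym (lookup-index (∈-vertices v)))

-- Both lists are duplicate-free and contain every vertex of `u`. This lets a sum over `u` be
-- computed over `t`.
map-vertices-↭ : (f : Vertex t ↔ Vertex u) → map (Inverse.to f) (vertices t) ↭ vertices u
map-vertices-↭ {t} {u} f = ∼bag⇒↭ (unique∧set⇒bag
  (Unique.map⁺ to-injective (vertices-unique t)) (vertices-unique u)
  (mk⇔ (λ _ → ∈-vertices _) (λ _ → to-surjective _)))
  where
  open Inverse f
  to-injective : ∀ {x y} → to x ≡ to y → x ≡ y
  to-injective {x} {y} eq =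
    trans (sym (strictlyInverseʳ x)) (trans (cong from eq) (strictlyInverseʳ y))
  to-surjective : ∀ v → v ∈ map to (vertices t)
  to-surjective v = subst (_∈ map to (vertices t)) (strictlyInverseˡ v)
                      (∈-map⁺ to (∈-vertices (from v)))

-- Depth and inversions

depth : Vertex t → ℕ
depth root        = 0
depth (below i v) = suc (depth v)

totalDepth : PRTree → ℕ
totalDepth t = sumℕ (map depth (vertices t))

forestDepth : ∀ ts → ForestVertex ts → ℕ
forestDepth ts (i , v) = depth v

totalForestDepth : List PRTree → ℕ
totalForestDepth ts = sumℕ (map (forestDepth ts) (forestVertices ts))

-- Serves both for `c = 1`, when subtrees are hung below a new root, and for the shift of depths
-- modulo 2 when the root moves.
sum-map-+ : ∀ {A : Set} (f : A → ℕ) c xs →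
            sumℕ (map (λ x → f x + c) xs) ≡ sumℕ (map f xs) + length xs * c
sum-map-+ f c []       = refl
sum-map-+ f c (x ∷ xs) = begin
  (f x + c) + sumℕ (map (λ x → f x + c) xs)      ≡⟨ cong (_+_ (f x + c)) (sum-map-+ f c xs) ⟩
  (f x + c) + (sumℕ (map f xs) + length xs * c)  ≡⟨ interchange (f x) c _ _ ⟩
  (f x + sumℕ (map f xs)) + (c + length xs * c)  ∎
  where
  open ≡-Reasoning
  interchange : ∀ a b c d → (a + b) + (c + d) ≡ (a + c) + (b + d)
  interchange = solve-∀

-- The root has depth 0, and every forest vertex moves down one level.
totalDepth-node : ∀ ts → totalDepth (node ts) ≡ totalForestDepth ts + length (forestVertices ts)
totalDepth-node ts = begin
  sumℕ (map depth (map (graft ts) F))          ≡⟨ cong sumℕ (sym (map-∘ F)) ⟩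
  sumℕ (map (suc ∘ forestDepth ts) F)        ≡⟨ cong sumℕ (map-cong (λ v → +-comm 1 (forestDepth ts v)) F) ⟩
  sumℕ (map (λ v → forestDepth ts v + 1) F)  ≡⟨ sum-map-+ (forestDepth ts) 1 F ⟩
  totalForestDepth ts + length F * 1     ≡⟨ cong (_+_ (totalForestDepth ts)) (*-identityʳ (length F)) ⟩
  totalForestDepth ts + length F         ∎
  where
  open ≡-Reasoning
  F = forestVertices ts

totalForestDepth-∷ : ∀ t ts → totalForestDepth (t ∷ ts) ≡ totalDepth t + totalForestDepth ts
totalForestDepth-∷ t ts = begin
  sumℕ (map (forestDepth (t ∷ ts)) (map (zero ,_) V ++ map (shift t ts) F))
    ≡⟨ cong sumℕ (map-++ (forestDepth (t ∷ ts)) (map (zero ,_) V) (map (shift t ts) F)) ⟩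
  sumℕ (map (forestDepth (t ∷ ts)) (map (zero ,_) V) ++ map (forestDepth (t ∷ ts)) (map (shift t ts) F))
    ≡⟨ cong₂ (λ xs ys → sumℕ (xs ++ ys)) (sym (map-∘ V)) (sym (map-∘ F)) ⟩
  sumℕ (map depth V ++ map (forestDepth ts) F)
    ≡⟨ sum-++ (map depth V) (map (forestDepth ts) F) ⟩
  totalDepth t + totalForestDepth ts  ∎
  where
  open ≡-Reasoning
  V = vertices t
  F = forestVertices ts

length-forestVertices-∷ : ∀ t ts →
  length (forestVertices (t ∷ ts)) ≡ size t + length (forestVertices ts)
length-forestVertices-∷ t ts =
  trans (length-++ (map (zero ,_) (vertices t)))
        (cong₂ _+_ (length-map _ (vertices t)) (length-map _ (forestVertices ts)))

size-node : ∀ ts → size (node ts) ≡ suc (length (forestVertices ts))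
size-node ts = cong suc (length-map (graft ts) (forestVertices ts))

closings : List Bracket → ℕ
closings []            = 0
closings (opening ∷ w) = closings w
closings (closing ∷ w) = suc (closings w)

openings-++ : ∀ v w → openings (v ++ w) ≡ openings v + openings w
openings-++ []            w = refl
openings-++ (opening ∷ v) w = cong suc (openings-++ v w)
openings-++ (closing ∷ v) w = openings-++ v w

closings-++ : ∀ v w → closings (v ++ w) ≡ closings v + closings w
closings-++ []            w = refl
closings-++ (opening ∷ v) w = closings-++ v w
closings-++ (closing ∷ v) w = cong suc (closings-++ v w)

-- The last term counts the inversions across the cut: every closing bracket of `v` precedes every
-- opening bracket of `w`.
inversions-++ : ∀ v w →
  inversions (v ++ w) ≡ inversions v + inversions w + closings v * openings w
inversions-++ []            w = sym (+-identityʳ (inversions w))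
inversions-++ (opening ∷ v) w = inversions-++ v w
inversions-++ (closing ∷ v) w = begin
  openings (v ++ w) + inversions (v ++ w)
    ≡⟨ cong₂ _+_ (openings-++ v w) (inversions-++ v w) ⟩
  (openings v + openings w) + (inversions v + inversions w + closings v * openings w)
    ≡⟨ rearrange (openings v) (openings w) (inversions v) (inversions w) (closings v * openings w) ⟩
  (openings v + inversions v) + inversions w + (openings w + closings v * openings w)  ∎
  where
  open ≡-Reasoning
  rearrange : ∀ a b c d e → (a + b) + (c + d + e) ≡ (a + c) + d + (b + e)
  rearrange = solve-∀

mutual
  -- Each vertex contributes exactly one pair of brackets.
  openings-code : ∀ t → openings (code t) ≡ size t
  openings-code (node ts) = begin
    suc (openings (codes ts ++ [ closing ]))  ≡⟨ cong suc (openings-++ (codes ts) _) ⟩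
    suc (openings (codes ts) + 0)             ≡⟨ cong suc (+-identityʳ _) ⟩
    suc (openings (codes ts))                 ≡⟨ cong suc (openings-codes ts) ⟩
    suc (length (forestVertices ts))          ≡⟨ sym (size-node ts) ⟩
    size (node ts)                            ∎
    where open ≡-Reasoning

  openings-codes : ∀ ts → openings (codes ts) ≡ length (forestVertices ts)
  openings-codes []       = refl
  openings-codes (t ∷ ts) = trans (openings-++ (code t) (codes ts))
    (trans (cong₂ _+_ (openings-code t) (openings-codes ts)) (sym (length-forestVertices-∷ t ts)))

mutual
  closings-code : ∀ t → closings (code t) ≡ size t
  closings-code (node ts) = begin
    closings (codes ts ++ [ closing ])  ≡⟨ closings-++ (codes ts) _ ⟩
    closings (codes ts) + 1             ≡⟨ +-comm _ 1 ⟩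
    suc (closings (codes ts))           ≡⟨ cong suc (closings-codes ts) ⟩
    suc (length (forestVertices ts))    ≡⟨ sym (size-node ts) ⟩
    size (node ts)                      ∎
    where open ≡-Reasoning

  closings-codes : ∀ ts → closings (codes ts) ≡ length (forestVertices ts)
  closings-codes []       = refl
  closings-codes (t ∷ ts) = trans (closings-++ (code t) (codes ts))
    (trans (cong₂ _+_ (closings-code t) (closings-codes ts)) (sym (length-forestVertices-∷ t ts)))

-- The number n(n-1)/2 of unordered pairs of distinct elements of an n-element set.
triangle : ℕ → ℕ
triangle zero    = 0
triangle (suc n) = n + triangle n

-- A pair in a disjoint union lies within one part or joins the two.
triangle-+ : ∀ m n → triangle (m + n) ≡ triangle m + triangle n + m * n
triangle-+ zero    n = sym (+-identityʳ (triangle n))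
triangle-+ (suc m) n = begin
  (m + n) + triangle (m + n)                     ≡⟨ cong (_+_ (m + n)) (triangle-+ m n) ⟩
  (m + n) + (triangle m + triangle n + m * n)    ≡⟨ rearrange m n (triangle m) (triangle n) (m * n) ⟩
  (m + triangle m) + triangle n + (n + m * n)    ∎
  where
  open ≡-Reasoning
  rearrange : ∀ a b c d e → (a + b) + (c + d + e) ≡ (a + c) + d + (b + e)
  rearrange = solve-∀

-- Of the pairs of distinct vertices, the incomparable ones are the inversions,
-- and the comparable ones are counted by the depth of the lower vertex.
mutual
  inversions+totalDepth : ∀ t → inversions (code t) + totalDepth t ≡ triangle (size t)
  inversions+totalDepth (node ts) = begin
    inversions (codes ts ++ [ closing ]) + totalDepth (node ts)
      -- The root's brackets come first and last, so neither takes part in an inversion.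
      ≡⟨ cong₂ _+_ (inversions-++ (codes ts) [ closing ]) (totalDepth-node ts) ⟩
    inversions (codes ts) + 0 + closings (codes ts) * 0 + (totalForestDepth ts + m)
      ≡⟨ rearrange (inversions (codes ts)) (closings (codes ts)) (totalForestDepth ts) m ⟩
    m + (inversions (codes ts) + totalForestDepth ts)
      -- The summand `m` counts the pairs containing the root, all of them comparable.
      ≡⟨ cong (_+_ m) (inversions+totalForestDepth ts) ⟩
    triangle (suc m)
      ≡⟨ cong triangle (sym (size-node ts)) ⟩
    triangle (size (node ts))  ∎
    where
    open ≡-Reasoning
    m = length (forestVertices ts)
    rearrange : ∀ a b c d → a + 0 + b * 0 + (c + d) ≡ d + (a + c)
    rearrange = solve-∀

  inversions+totalForestDepth : ∀ ts →
    inversions (codes ts) + totalForestDepth ts ≡ triangle (length (forestVertices ts))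
  inversions+totalForestDepth []       = refl
  inversions+totalForestDepth (t ∷ ts) = begin
    inversions (code t ++ codes ts) + totalForestDepth (t ∷ ts)
      ≡⟨ cong₂ _+_ (inversions-++ (code t) (codes ts)) (totalForestDepth-∷ t ts) ⟩
    inversions (code t) + inversions (codes ts) + closings (code t) * openings (codes ts)
      + (totalDepth t + totalForestDepth ts)
      ≡⟨ cong₂ (λ a b → inversions (code t) + inversions (codes ts) + a * b
                          + (totalDepth t + totalForestDepth ts))
               -- The product becomes the number of pairs with one vertex in `t` and one in a later
               -- subtree, all incomparable.
               (closings-code t) (openings-codes ts) ⟩
    inversions (code t) + inversions (codes ts) + size t * m + (totalDepth t + totalForestDepth ts)
      ≡⟨ rearrange (inversions (code t)) (inversions (codes ts)) (size t * m) _ _ ⟩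
    (inversions (code t) + totalDepth t) + (inversions (codes ts) + totalForestDepth ts) + size t * m
      ≡⟨ cong₂ (λ a b → a + b + size t * m)
               (inversions+totalDepth t) (inversions+totalForestDepth ts) ⟩
    triangle (size t) + triangle m + size t * m
      ≡⟨ sym (triangle-+ (size t) m) ⟩
    triangle (size t + m)
      ≡⟨ cong triangle (sym (length-forestVertices-∷ t ts)) ⟩
    triangle (length (forestVertices (t ∷ ts)))  ∎
    where
    open ≡-Reasoning
    m = length (forestVertices ts)
    rearrange : ∀ a b c d e → a + b + c + (d + e) ≡ (a + d) + (b + e) + c
    rearrange = solve-∀

-- Parity is a graph invariant in even order

parity-suc : ∀ n → parity (suc n) ≡ parity n ⁻¹
parity-suc n = sym (ℙ.⁻¹-selfInverse (ℙ.suc-homo-⁻¹ n))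

⁻¹-+ : ∀ p q → p ⁻¹ ℙ.+ q ≡ (p ℙ.+ q) ⁻¹
⁻¹-+ 0ℙ q = refl
⁻¹-+ 1ℙ q = sym (ℙ.⁻¹-involutive q)

depth-child : {v w : Vertex t} → ChildOf v w → depth v ≡ suc (depth w)
depth-child (root i)    = refl
depth-child (below i c) = cong suc (depth-child c)

-- Parity of depth is thus a proper 2-colouring of the unrooted tree, a notion that isomorphisms
-- preserve.
depth-adj : {v w : Vertex t} → PRAdj t v w → parity (depth v) ≡ parity (depth w) ⁻¹
depth-adj {v = v} {w} (inj₁ c) = trans (cong parity (depth-child c)) (parity-suc (depth w))
depth-adj {v = v} {w} (inj₂ c) =
  sym (ℙ.⁻¹-selfInverse (sym (trans (cong parity (depth-child c)) (parity-suc (depth v)))))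

-- A proper 2-colouring is fixed by its value at the root. The induction restricts `k` to the
-- subtree at `i`, whose root has the colour opposite to that of `root`.
2-colouring-unique : (k : Vertex t → Parity) →
  (∀ {v w} → ChildOf v w → k v ≡ k w ⁻¹) → ∀ v → k v ≡ parity (depth v) ℙ.+ k root
2-colouring-unique k proper root        = refl
2-colouring-unique k proper (below i v) = begin
  k (below i v)                              ≡⟨ 2-colouring-unique (k ∘ below i) (proper ∘ below i) v ⟩
  parity (depth v) ℙ.+ k (below i root)      ≡⟨ cong (parity (depth v) ℙ.+_) (proper (root i)) ⟩
  parity (depth v) ℙ.+ k root ⁻¹             ≡⟨ ℙ.+-comm (parity (depth v)) _ ⟩
  k root ⁻¹ ℙ.+ parity (depth v)             ≡⟨ ⁻¹-+ (k root) _ ⟩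
  (k root ℙ.+ parity (depth v)) ⁻¹           ≡⟨ cong _⁻¹ (ℙ.+-comm (k root) _) ⟩
  (parity (depth v) ℙ.+ k root) ⁻¹           ≡⟨ sym (⁻¹-+ (parity (depth v)) _) ⟩
  parity (depth v) ⁻¹ ℙ.+ k root             ≡⟨ cong (ℙ._+ k root) (sym (parity-suc (depth v))) ⟩
  parity (suc (depth v)) ℙ.+ k root          ∎
  where open ≡-Reasoning

parity-sum-cong : ∀ {A : Set} {f g : A → ℕ} → (∀ x → parity (f x) ≡ parity (g x)) →
                  ∀ xs → parity (sumℕ (map f xs)) ≡ parity (sumℕ (map g xs))
parity-sum-cong             eq []       = refl
parity-sum-cong {f = f} {g} eq (x ∷ xs) = begin
  parity (f x + sumℕ (map f xs))            ≡⟨ ℙ.+-homo-+ (f x) _ ⟩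
  parity (f x) ℙ.+ parity (sumℕ (map f xs)) ≡⟨ cong₂ ℙ._+_ (eq x) (parity-sum-cong eq xs) ⟩
  parity (g x) ℙ.+ parity (sumℕ (map g xs)) ≡⟨ sym (ℙ.+-homo-+ (g x) _) ⟩
  parity (g x + sumℕ (map g xs))            ∎
  where open ≡-Reasoning

-- The identity `inversions+totalDepth` modulo 2, where subtracting the total depth is the same as
-- adding it.
prParity-depth : ∀ t → prParity t ≡ parity (triangle (size t)) ℙ.+ parity (totalDepth t)
prParity-depth t = ℙ.+-cancelʳ-≡ (parity (totalDepth t)) _ _ (begin
  prParity t ℙ.+ d                        ≡⟨ sym (ℙ.+-homo-+ (inversions (code t)) _) ⟩
  parity (inversions (code t) + totalDepth t) ≡⟨ cong parity (inversions+totalDepth t) ⟩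
  parity (triangle (size t))              ≡⟨ sym (ℙ.+-identityʳ _) ⟩
  parity (triangle (size t)) ℙ.+ 0ℙ       ≡⟨ cong (parity (triangle (size t)) ℙ.+_) (sym (ℙ.p+p≡0ℙ d)) ⟩
  parity (triangle (size t)) ℙ.+ (d ℙ.+ d) ≡⟨ sym (ℙ.+-assoc (parity (triangle (size t))) d d) ⟩
  parity (triangle (size t)) ℙ.+ d ℙ.+ d  ∎)
  where
  open ≡-Reasoning
  d = parity (totalDepth t)

module _ (t u : PRTree) (even : parity (size t) ≡ 0ℙ) (iso : AdjIso (PRAdj t) (PRAdj u)) where
  open Inverse (proj₁ iso) using (to)
  open ≡-Reasoning

  private
    -- The depth in `u` of the image of the root of `t`; modulo 2 the two depth functions differ by
    -- this constant.
    r = depth (to root)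

    depth-to : ∀ v → parity (depth (to v)) ≡ parity (depth v + r)
    depth-to v = begin
      parity (depth (to v))             ≡⟨ 2-colouring-unique (parity ∘ depth ∘ to)
                                             (λ c → depth-adj (Equivalence.to (proj₂ iso _ _) (inj₁ c))) v ⟩
      parity (depth v) ℙ.+ parity r     ≡⟨ sym (ℙ.+-homo-+ (depth v) r) ⟩
      parity (depth v + r)              ∎

    size-≡ : size u ≡ size t
    size-≡ = trans (sym (↭-length (map-vertices-↭ (proj₁ iso)))) (length-map to (vertices t))

  -- Modulo 2 each of the `size t` depths is shifted by `r`, and the total shift `size t * r` is
  -- even because `size t` is.
  totalDepth-invariant : parity (totalDepth u) ≡ parity (totalDepth t)
  totalDepth-invariant = begin
    parity (sumℕ (map depth (vertices u)))
      ≡⟨ cong parity (sym (sum-↭ (↭-map⁺ depth (map-vertices-↭ (proj₁ iso))))) ⟩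
    parity (sumℕ (map depth (map to (vertices t))))
      ≡⟨ cong (parity ∘ sumℕ) (sym (map-∘ (vertices t))) ⟩
    parity (sumℕ (map (depth ∘ to) (vertices t)))
      ≡⟨ parity-sum-cong depth-to (vertices t) ⟩
    parity (sumℕ (map (λ v → depth v + r) (vertices t)))
      ≡⟨ cong parity (sum-map-+ depth r (vertices t)) ⟩
    parity (totalDepth t + size t * r)
      ≡⟨ ℙ.+-homo-+ (totalDepth t) _ ⟩
    parity (totalDepth t) ℙ.+ parity (size t * r)
      ≡⟨ cong (parity (totalDepth t) ℙ.+_) (ℙ.*-homo-* (size t) r) ⟩
    parity (totalDepth t) ℙ.+ (parity (size t) ℙ.* parity r)
      ≡⟨ cong (λ p → parity (totalDepth t) ℙ.+ (p ℙ.* parity r)) even ⟩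
    parity (totalDepth t) ℙ.+ 0ℙ
      ≡⟨ ℙ.+-identityʳ _ ⟩
    parity (totalDepth t)  ∎

  prParity-invariant : prParity u ≡ prParity t
  prParity-invariant = begin
    prParity u
      ≡⟨ prParity-depth u ⟩
    parity (triangle (size u)) ℙ.+ parity (totalDepth u)
      ≡⟨ cong₂ (λ n p → parity (triangle n) ℙ.+ p) size-≡ totalDepth-invariant ⟩
    parity (triangle (size t)) ℙ.+ parity (totalDepth t)
      ≡⟨ sym (prParity-depth t) ⟩
    prParity t  ∎

-- Acyclicity of graphs with a parent relation

module _ {n} (G : Graph n) (Parent : Rel (Fin n) 0ℓ) (height : Fin n → ℕ)
  (adj-parent    : ∀ {v w} → Adj G v w → Parent v w ⊎ Parent w v)
  (height-parent : ∀ {v w} → Parent v w → height v ≡ suc (height w))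
  (parent-unique : ∀ {v w x} → Parent v w → Parent v x → w ≡ x)
  where

  private
    parent-< : ∀ {v w} → Parent v w → height w < height v
    parent-< {v} {w} p = subst (height w <_) (sym (height-parent p)) (n<1+n (height w))

  -- A walk from v to z with first step v → w that never turns back along the
  -- edge just traversed; Q holds of its last vertex before z.
  data Walk (Q : Fin n → Set) : (v w z : Fin n) → Set where
    stop : ∀ {v w} → Q v → Adj G v w → Walk Q v w w
    step : ∀ {v w x z} → Adj G v w → v ≢ x → Walk Q w x z → Walk Q v w z

  -- The head of `xs ++ [ z ]`: the target of the first step of the walk built by `toWalk`.
  next : List (Fin n) → Fin n → Fin n
  next []      z = z
  next (x ∷ _) z = x

  ≢-next : ∀ {v xs z} → All (v ≢_) xs → v ≢ z → v ≢ next xs z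
  ≢-next []       v≢z = v≢z
  ≢-next (v≢ ∷ _) v≢z = v≢

  module _ {Q : Fin n → Set} where

    first : ∀ {v w z} → Walk Q v w z → Adj G v w
    first (stop _ a)   = a
    first (step a _ _) = a

    -- After a step down, the only step up is to turn back.
    descend : ∀ {v w z} → Walk Q v w z → Parent w v →
              height v < height z × ∃[ y ] (Q y × Parent z y)
    descend (stop q a)         p = parent-< p , _ , q , p
    descend (step a v≢x walk) p with adj-parent (first walk)
    ... | inj₁ p′ = contradiction (parent-unique p p′) v≢x
    ... | inj₂ p′ with descend walk p′
    ... | h , last = <-trans (parent-< p) h , last

    -- A walk that never turns back climbs for a while and then only descends. Here `height` grows
    -- away from the root: a walk that only climbs ends at a smaller height, and any other ends with
    -- a step from the parent of `z` down to `z`.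
    lower-or-descending : ∀ {v w z} → Walk Q v w z →
                          height z < height v ⊎ ∃[ y ] (Q y × Parent z y)
    lower-or-descending walk with adj-parent (first walk)
    lower-or-descending walk              | inj₂ p = inj₂ (proj₂ (descend walk p))
    lower-or-descending (stop _ _)        | inj₁ p = inj₁ (parent-< p)
    lower-or-descending (step _ _ walk)   | inj₁ p with lower-or-descending walk
    ... | inj₁ h    = inj₁ (<-trans h (parent-< p))
    ... | inj₂ last = inj₂ last

    -- Turning back would repeat a vertex two places later: a listed one, excluded by `Unique`, or
    -- the endpoint `z`, which is outside that list and excluded separately.
    toWalk : ∀ {v xs z} → Linked (Adj G) (v ∷ xs ++ [ z ]) → Unique (v ∷ xs) →
             All (_≢ z) (v ∷ xs) → All Q (v ∷ xs) → Walk Q v (next xs z) z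
    toWalk {xs = []}    (a ∷ _) _ _ (q ∷ _) = stop q a
    toWalk {xs = _ ∷ _} (a ∷ as) ((_ ∷ v≢) ∷ uniq) (v≢z ∷ ≢z) (_ ∷ qs) =
      step a (≢-next v≢ v≢z) (toWalk as uniq ≢z qs)

  acyclic : Acyclic G
  acyclic v []             (s≤s () , _)
  acyclic v (w ∷ [])       (s≤s (s≤s ()) , _)
  acyclic v (w ∷ x ∷ xs) (_ , (v≢w ∷ v≢x ∷ v≢xs) ∷ (w≢x ∷ w≢xs) ∷ uniq , vw ∷ wx ∷ linked) =
    conclude (adj-parent vw) (adj-parent wx) (lower-or-descending walk)
    where
    -- The rest of the cycle after `w`. Taking `w ≢_` for `Q` records that the return to `v` is not
    -- made from `w`.
    walk : Walk (w ≢_) x (next xs v) v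
    walk = toWalk linked uniq (All.map (_∘ sym) (v≢x ∷ v≢xs)) (w≢x ∷ w≢xs)

    cycle : Walk (w ≢_) v w v
    cycle = step vw v≢x (step wx (≢-next w≢xs (v≢w ∘ sym)) walk)

    -- If w is the parent of v, the cycle cannot return to v by descending, since
    -- it would do so from w, nor by staying below the height of x.
    conclude : Parent v w ⊎ Parent w v → Parent w x ⊎ Parent x w →
               height v < height x ⊎ ∃[ y ] (w ≢ y × Parent v y) → ⊥
    -- If `w` is a child of `v`, the whole cycle descends and `v` would lie strictly below itself.
    conclude (inj₂ wv) _         _                     = <-irrefl refl (proj₁ (descend cycle wv))
    conclude (inj₁ vw) _         (inj₂ (_ , w≢y , vy)) = w≢y (parent-unique vw vy)
    conclude (inj₁ vw) (inj₁ wx) (inj₁ v<x)            =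
      <-irrefl refl (<-trans v<x (<-trans (parent-< wx) (parent-< vw)))
    -- Both `v` and `x` are children of `w`, hence at equal height.
    conclude (inj₁ vw) (inj₂ xw) (inj₁ v<x)            =
      <-irrefl (trans (height-parent vw) (sym (height-parent xw))) v<x

-- The graph of a plane rooted tree

root? : (v : Vertex t) → Dec (v ≡ root)
root? root        = yes refl
root? (below i v) = no λ ()

root-no-parent : {v : Vertex t} → ¬ ChildOf root v
root-no-parent ()

childOf? : Decidable (ChildOf {t})
childOf? root        w    = no root-no-parent
childOf? (below i v) root = map′ (λ { refl → root i }) (λ { (root _) → refl }) (root? v)
childOf? (below i v) (below j w) with i Fin.≟ j
... | no  i≢j  = no λ { (below _ _) → i≢j refl }
... | yes refl = map′ (below i) (λ { (below _ c) → c }) (childOf? v w)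

childOf-irrefl : {v : Vertex t} → ¬ ChildOf v v
childOf-irrefl (below i c) = childOf-irrefl c

parent-unique : {v w x : Vertex t} → ChildOf v w → ChildOf v x → w ≡ x
parent-unique (root i)    (root _)     = refl
parent-unique (root i)    (below _ c)  = contradiction c root-no-parent
parent-unique (below i c) (root _)     = contradiction c root-no-parent
parent-unique (below i c) (below _ c′) = cong (below i) (parent-unique c c′)

vertexAt : ∀ t → Fin (size t) → Vertex t
vertexAt t = Inverse.from (enumeration t)

-- The vertices are numbered in preorder, and adjacency is decided structurally, so that adjacency
-- matrices of concrete trees evaluate.
treeGraph : ∀ t → Graph (size t)
treeGraph t .Adj i j        = PRAdj t (vertexAt t i) (vertexAt t j)
treeGraph t .adj? i j       = childOf? (vertexAt t i) (vertexAt t j) ⊎-dec childOf? (vertexAt t j) (vertexAt t i)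
treeGraph t .adj-sym        = swap
treeGraph t .adj-irrefl (inj₁ c) = childOf-irrefl c
treeGraph t .adj-irrefl (inj₂ c) = childOf-irrefl c

isPRTreeOf-treeGraph : ∀ t → t IsPRTreeOf treeGraph t
isPRTreeOf-treeGraph t = enumeration t , λ v w →
  mk⇔ (subst₂ (PRAdj t) (sym (strictlyInverseʳ v)) (sym (strictlyInverseʳ w)))
      (subst₂ (PRAdj t) (strictlyInverseʳ v) (strictlyInverseʳ w))
  where open Inverse (enumeration t)

PRAdj-below : ∀ i {v w : Vertex (lookup ts i)} →
              PRAdj (lookup ts i) v w → PRAdj (node ts) (below i v) (below i w)
PRAdj-below i (inj₁ c) = inj₁ (below i c)
PRAdj-below i (inj₂ c) = inj₂ (below i c)

toRoot : (v : Vertex t) → Star (PRAdj t) v root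
toRoot root        = ε
toRoot (below i v) = Star.gmap (below i) (PRAdj-below i) (toRoot v) ◅◅ inj₁ (root i) ◅ ε

PRAdj-connected : (v w : Vertex t) → Star (PRAdj t) v w
PRAdj-connected v w = toRoot v ◅◅ Star.reverse swap (toRoot w)

treeGraph-connected : ∀ t → Connected (treeGraph t)
treeGraph-connected t i j = subst₂ (Star (Adj (treeGraph t))) (strictlyInverseˡ i) (strictlyInverseˡ j)
  (Star.gmap to (λ {v} {w} → Equivalence.to (proj₂ (isPRTreeOf-treeGraph t) v w))
             (PRAdj-connected (from i) (from j)))
  where open Inverse (enumeration t)

treeGraph-acyclic : ∀ t → Acyclic (treeGraph t)
treeGraph-acyclic t = acyclic (treeGraph t)
  -- Distance from the root serves as `height`; adjacency is by definition the disjunction of the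
  -- two parent directions, hence `id`.
  (λ i j → ChildOf (from i) (from j)) (depth ∘ from) id depth-child
  (λ {i} {j} {k} c c′ → from-injective (parent-unique c c′))
  where
  open Inverse (enumeration t)
  from-injective : ∀ {i j} → from i ≡ from j → i ≡ j
  from-injective {i} {j} eq =
    trans (sym (strictlyInverseˡ i)) (trans (cong to eq) (strictlyInverseˡ j))

treeGraph-isTree : ∀ t → IsTree (treeGraph t)
treeGraph-isTree t@(node ts) = s≤s z≤n , treeGraph-connected t , treeGraph-acyclic t

-- Transport of parity along isomorphisms

AdjIso-sym : ∀ {A B : Set} (_∼₁_ : Rel A 0ℓ) (_∼₂_ : Rel B 0ℓ) →
             AdjIso _∼₁_ _∼₂_ → AdjIso _∼₂_ _∼₁_
AdjIso-sym _ _∼₂_ (f , f-adj) = ↔-sym f , λ x y →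
  mk⇔ (λ r → Equivalence.from (f-adj _ _)
         (subst₂ _∼₂_ (sym (strictlyInverseˡ x)) (sym (strictlyInverseˡ y)) r))
      (λ r → subst₂ _∼₂_ (strictlyInverseˡ x) (strictlyInverseˡ y) (Equivalence.to (f-adj _ _) r))
  where open Inverse f

AdjIso-trans : ∀ {A B C : Set} (_∼₁_ : Rel A 0ℓ) (_∼₂_ : Rel B 0ℓ) (_∼₃_ : Rel C 0ℓ) →
               AdjIso _∼₁_ _∼₂_ → AdjIso _∼₂_ _∼₃_ → AdjIso _∼₁_ _∼₃_
AdjIso-trans _ _ _ (f , f-adj) (g , g-adj) = g ↔-∘ f , λ x y → g-adj _ _ ⇔-∘ f-adj x y

-- Any other pr-tree of the graph is isomorphic to `t`, as an unrooted tree, by way of the graph;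
-- `prParity-invariant` then applies.
treeGraph-hasParity : ∀ t → parity (size t) ≡ 0ℙ → HasParity (treeGraph t) (prParity t)
treeGraph-hasParity t even = (t , isPRTreeOf-treeGraph t) , λ u u-of →
  prParity-invariant t u even
    (AdjIso-trans (PRAdj t) (Adj (treeGraph t)) (PRAdj u)
      (isPRTreeOf-treeGraph t) (AdjIso-sym (PRAdj u) (Adj (treeGraph t)) u-of))

-- A pr-tree of `G` is also one of `H`, so its parity is both `p` and `q`. This tells the two
-- witnesses apart.
HasParity-≅ : ∀ {n} {G H : Graph n} {p q} → HasParity G p → HasParity H q → G ≅ H → p ≡ q
HasParity-≅ {G = G} {H} ((t , t-of-G) , parity-G) (_ , parity-H) iso =
  trans (sym (parity-G t t-of-G)) (parity-H t (AdjIso-trans (PRAdj t) (Adj G) (Adj H) t-of-G iso))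

-- The two witnesses

pattern leaf = node []

-- Rooted so that in preorder the Laplace expansion has few nonzero branches.
evenTree oddTree : PRTree
evenTree = node [ node (leaf ∷ [ node (leaf ∷ [ node [ node (leaf ∷ [ node [ node [ node [ leaf ] ] ] ]) ] ]) ]) ]
oddTree  = node [ node (leaf ∷ [ node [ node [ node (leaf ∷ [ node (leaf ∷ [ node [ node [ leaf ] ] ]) ]) ] ] ]) ]

-- Caterpillars: a path on nine vertices with three pendant leaves, attached to its vertices 2, 3, 5
-- in the even tree and 2, 5, 6 in the odd one.
evenGraph oddGraph : Graph 12
evenGraph = treeGraph evenTree
oddGraph  = treeGraph oddTree

characteristic : Poly
characteristic = (+ 1) X^ 12 ⊖ (+ 11) X^ 10 ⊕ (+ 42) X^ 8 ⊖ (+ 66) X^ 6 ⊕ (+ 39) X^ 4 ⊖ (+ 6) X^ 2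

-- The Laplace expansion evaluates to the very same coefficient list, so equality holds even without
-- identifying lists up to trailing zeros.
evenGraph-charPoly : graphCharPoly evenGraph ≡ characteristic
evenGraph-charPoly = refl

oddGraph-charPoly : graphCharPoly oddGraph ≡ characteristic
oddGraph-charPoly = refl

≡⇒≈ : ∀ p q → p ≡ q → p ≈ q
≡⇒≈ p q eq k = cong (λ r → coeff r k) eq

evenGraph-hasParity : EvenTree evenGraph
-- Evaluation shows both that 12 is even and that this embedding has an even number of inversions.
evenGraph-hasParity = treeGraph-hasParity evenTree refl

oddGraph-hasParity : OddTree oddGraph
oddGraph-hasParity = treeGraph-hasParity oddTree refl

evenGraph≇oddGraph : ¬ (evenGraph ≅ oddGraph)
evenGraph≇oddGraph = ℙ.p≢p⁻¹ 0ℙ ∘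
  HasParity-≅ {G = evenGraph} {oddGraph} evenGraph-hasParity oddGraph-hasParity

cospectral : Cospectral evenGraph oddGraph
cospectral = evenGraph≇oddGraph , ≡⇒≈ (graphCharPoly evenGraph) (graphCharPoly oddGraph)
                                       (trans evenGraph-charPoly (sym oddGraph-charPoly))

mainTheorem8 : ∃[ S ] ∃[ T ]
    IsTree {12} S × IsTree {12} T × Cospectral S T
    × (graphCharPoly S ≈ (+ 1) X^ 12 ⊖ (+ 11) X^ 10 ⊕ (+ 42) X^ 8 ⊖ (+ 66) X^ 6 ⊕ (+ 39) X^ 4 ⊖ (+ 6) X^ 2)
    × (graphCharPoly T ≈ (+ 1) X^ 12 ⊖ (+ 11) X^ 10 ⊕ (+ 42) X^ 8 ⊖ (+ 66) X^ 6 ⊕ (+ 39) X^ 4 ⊖ (+ 6) X^ 2)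
    × EvenTree S × OddTree T
mainTheorem8 =
  evenGraph , oddGraph ,
  treeGraph-isTree evenTree , treeGraph-isTree oddTree , cospectral ,
  ≡⇒≈ (graphCharPoly evenGraph) characteristic evenGraph-charPoly ,
  ≡⇒≈ (graphCharPoly oddGraph) characteristic oddGraph-charPoly ,
  evenGraph-hasParity , oddGraph-hasParity
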